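{- Let $f:A\times B\to C\times D$ be a bijection. Then $f$ is semilocalizable if and only if the following three conditions are met: (1) $f$ is semicausal; (2) the dual $\tilde f: D\times C\to B\times A$ is semicausal; (3) for every $a,a'\in A$ and $b,b'\in B$, if $f(a,b)_D=f(a',b)_D$ then $f(a,b')_D=f(a',b')_D$.
   Context: Here $A,B,C,D$ are sets. For $f:A\times B\to C\times D$, $f(a,b)_C$ and $f(a,b)_D$ denote the components of $f(a,b)$ in $C$ and in $D$; similarly for other maps into products. Semicausal: a function $f:A\times B\to C\times D$ is semicausal if its $C$-component depends only on the $A$-component of the input, i.e. there exists $g:A\to C$ such that $f(a,b)_C=g(a)$ for all $a\in A$, $b\in B$. Dual: for a bijection $f:A\times B\to C\times D$, the dual $\tilde f:D\times C\to B\times A$ is obtained from $f^{ -1}$ by reversing the order of the pairs on both sides: $\tilde f(d,c)=(b,a)$ where $f^{ -1}(c,d)=(a,b)$. Semicausality of $\tilde f$ thus means that there is a function $k:D\to B$ such that the $B$-component of $f^{ -1}(c,d)$ equals $k(d)$ for all $c\in C$, $d\in D$. Semilocalizable: a bijection $f:A\times B\to C\times D$ is (reversibly) semilocalizable if there exist a set $E$ and bijections $g:A\to C\times E$ and $h:D\to B\times E$ such that for all $a\in A$, $b\in B$, $f(a,b)=\bigl(g_C(a),\,h^{ -1}(b,g_E(a))\bigr)$, where $g(a)=(g_C(a),g_E(a))$.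
   Formalization: For the "if" direction, B and C are assumed non-empty; without this the claim fails, e.g. for A a one-point set, C a two-point set and B = D empty, where (1)–(3) hold but there is no bijection A → C × E. -}

module Defs where

open import Level using (Level; suc)
open import Data.Product.Base using (Σ; Σ-syntax; _×_; _,_; proj₁; proj₂)
open import Data.Product.Algebra using (×-comm)
open import Function.Bundles using (_↔_; module Inverse)
open import Function.Construct.Composition using (_↔-∘_)
open import Function.Construct.Symmetry using (↔-sym)
open import Relation.Binary.PropositionalEquality using (_≡_)

open Inverse using (to; from)

private
  variable
    ℓ : Level
    A B C D : Set ℓ

Semicausal : (A × B → C × D) → Set _
Semicausal {A = A} {B = B} {C = C} f =
  Σ[ g ∈ (A → C) ] (∀ (a : A) (b : B) → proj₁ (f (a , b)) ≡ g a)

dual : (A × B) ↔ (C × D) → (D × C) ↔ (B × A)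
dual {A = A} {B = B} {C = C} {D = D} f =
  ×-comm A B ↔-∘ (↔-sym f ↔-∘ ×-comm D C)

-- E ranges over the universe in which A, B, C and D live.
Semilocalizable : {A B C D : Set ℓ} → (A × B) ↔ (C × D) → Set (suc ℓ)
Semilocalizable {ℓ = ℓ} {A = A} {B = B} {C = C} {D = D} f =
  Σ[ E ∈ Set ℓ ] Σ[ g ∈ A ↔ (C × E) ] Σ[ h ∈ D ↔ (B × E) ]
    (∀ (a : A) (b : B) →
      to f (a , b) ≡ (proj₁ (to g a) , from h (b , proj₂ (to g a))))

-- Whether two first inputs yield the same D-component does not depend on the
-- common second input.
SecondInputIrrelevant : (A × B → C × D) → Set _
SecondInputIrrelevant {A = A} {B = B} f =
  ∀ (a a' : A) (b b' : B) →
    proj₂ (f (a , b)) ≡ proj₂ (f (a' , b)) →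
    proj₂ (f (a , b')) ≡ proj₂ (f (a' , b'))

{-# OPTIONS --safe #-}

-- A semicausal f over g : A → C is a bijection A × B ↔ C × D commuting with the
-- maps to C, so it restricts to fibres over a point c₀: with E = g⁻¹(c₀) this is
-- E × B ↔ D. Likewise, semicausality of the dual over k : D → B gives
-- A ↔ C × k⁻¹(b₀), and the fibre of D ↔ B × E over b₀ identifies k⁻¹(b₀) with E.
-- The element of E attached to a is some a' with f(a', b₀)_D = f(a, b₀)_D, and
-- the third condition carries this equality from b₀ to every b.
module Submission where

open import Defs
open import Data.Product.Base using (Σ; Σ-syntax; _×_; _,_; proj₁; proj₂)
open import Data.Product.Function.Dependent.Propositional using (Σ-↔)
open import Data.Product.Function.NonDependent.Propositional using (_×-↔_)
open import Function.Bundles using (_↔_; module Inverse; mk↔ₛ′)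
open import Function.Construct.Composition using (_↔-∘_)
open import Function.Construct.Identity using (↔-id)
open import Function.Construct.Symmetry using (↔-sym)
open import Level using (Level)
open import Relation.Binary.PropositionalEquality
  using (_≡_; refl; sym; trans; cong; cong₂; module ≡-Reasoning)

open Inverse using (to; from; strictlyInverseˡ; strictlyInverseʳ)

private
  variable
    ℓ : Level
    A B C D : Set ℓ

≡-rebase : {x y z : A} → x ≡ y → (x ≡ z) ↔ (y ≡ z)
≡-rebase refl = ↔-id _

fibre-proj₁ : (b₀ : B) → (Σ[ x ∈ B × C ] proj₁ x ≡ b₀) ↔ C
fibre-proj₁ b₀ = mk↔ₛ′ (λ x → proj₂ (proj₁ x)) (λ c → (b₀ , c) , refl)
  (λ _ → refl) (λ { (_ , refl) → refl })

-- `p` is kept apart from `proj₁` after `to e` because the maps used below, `g` after `proj₁` and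
-- `k`, agree with it only pointwise.
fibre-over-proj₁ : (e : A ↔ (B × C)) (p : A → B) → (∀ x → p x ≡ proj₁ (to e x)) →
  (b₀ : B) → (Σ[ x ∈ A ] p x ≡ b₀) ↔ C
fibre-over-proj₁ e p p≗ b₀ =
  fibre-proj₁ b₀ ↔-∘ Σ-↔ e (λ {x} → ≡-rebase (p≗ x))

×-Σ-regroup : {P : A → Set ℓ} → (B × Σ A P) ↔ (Σ[ x ∈ A × B ] P (proj₁ x))
×-Σ-regroup = mk↔ₛ′ (λ (b , a , p) → (a , b) , p) (λ ((a , b) , p) → b , a , p)
  (λ _ → refl) (λ _ → refl)

-- The fibre of `g` after `proj₁` over `c₀` is counted twice: regrouping gives the right side,
-- transport along `f` gives `D`.
semicausal-split : (f : (A × B) ↔ (C × D)) ((g , _) : Semicausal (to f)) (c₀ : C) →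
  D ↔ (B × (Σ[ a ∈ A ] g a ≡ c₀))
semicausal-split f (g , f≗g) c₀ = ↔-sym
  (fibre-over-proj₁ f (λ x → g (proj₁ x)) (λ (a , b) → sym (f≗g a b)) c₀
    ↔-∘ ×-Σ-regroup)

module _ {A B C D : Set ℓ} (f : (A × B) ↔ (C × D)) where

  semilocalizable⇒ : Semilocalizable f →
    Semicausal (to f) × Semicausal (to (dual f)) × SecondInputIrrelevant (to f)
  semilocalizable⇒ (E , g , h , f≗) =
      ((λ a → proj₁ (to g a)) , λ a b → cong proj₁ (f≗ a b))
    , ((λ d → proj₁ (to h d)) , dual-causal)
    , irrelevant
    where
    open ≡-Reasoning

    -- `h` decodes the `D`-output into `b` and the `E`-part of `a`. The first half yields
    -- semicausality of the dual, the second the third condition.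
    to-h-f : ∀ a b → to h (proj₂ (to f (a , b))) ≡ (b , proj₂ (to g a))
    to-h-f a b = trans (cong (λ x → to h (proj₂ x)) (f≗ a b)) (strictlyInverseˡ h _)

    dual-causal : ∀ d c → proj₂ (from f (c , d)) ≡ proj₁ (to h d)
    dual-causal d c = begin
      proj₂ (from f (c , d))
        ≡⟨ cong proj₁ (to-h-f _ _) ⟨
      proj₁ (to h (proj₂ (to f (from f (c , d)))))
        ≡⟨ cong (λ x → proj₁ (to h (proj₂ x))) (strictlyInverseˡ f (c , d)) ⟩
      proj₁ (to h d) ∎

    irrelevant : SecondInputIrrelevant (to f)
    irrelevant a a' b b' eq = begin
      proj₂ (to f (a , b'))          ≡⟨ cong proj₂ (f≗ a b') ⟩
      from h (b' , proj₂ (to g a))   ≡⟨ cong (λ e → from h (b' , e)) same-E ⟩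
      from h (b' , proj₂ (to g a'))  ≡⟨ cong proj₂ (f≗ a' b') ⟨
      proj₂ (to f (a' , b'))         ∎
      where
      same-E : proj₂ (to g a) ≡ proj₂ (to g a')
      same-E = cong proj₂ (trans (sym (to-h-f a b)) (trans (cong (to h) eq) (to-h-f a' b)))

  -- The points are the bases of the fibres. With `B`, `D` empty, `A` a singleton and `C` of two
  -- elements, the conditions hold but no `A ↔ (C × E)` exists.
  ⇒semilocalizable : B → C →
    Semicausal (to f) × Semicausal (to (dual f)) × SecondInputIrrelevant (to f) →
    Semilocalizable f
  ⇒semilocalizable b₀ c₀ (causal@(g , f≗g) , dual-causal@(k , f⁻¹≗k) , irrelevant) =
    E , (↔-id C ×-↔ k⁻¹b₀↔E) ↔-∘ semicausal-split (dual f) dual-causal b₀ , h , f≗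
    where
    open ≡-Reasoning

    E : Set _
    E = Σ[ a ∈ A ] g a ≡ c₀

    h : D ↔ (B × E)
    h = semicausal-split f causal c₀

    k⁻¹b₀↔E : (Σ[ d ∈ D ] k d ≡ b₀) ↔ E
    -- The `B`-part of `to h d` computes to that of `from f (c₀ , d)`.
    k⁻¹b₀↔E = fibre-over-proj₁ h k (λ d → sym (f⁻¹≗k d c₀)) b₀

    k-f : ∀ a b → k (proj₂ (to f (a , b))) ≡ b
    k-f a b = trans (sym (f⁻¹≗k _ _)) (cong proj₂ (strictlyInverseʳ f (a , b)))

    rep : A → A
    rep a = proj₁ (proj₂ (to h (proj₂ (to f (a , b₀)))))

    f-rep : ∀ a → proj₂ (to f (a , b₀)) ≡ proj₂ (to f (rep a , b₀))
    f-rep a = begin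
      -- `from h (b , a' , _)` computes to the `D`-part of `f` at `(a' , b)`, so the round trip
      -- through `h` already brings in `rep a`.
      d                                     ≡⟨ strictlyInverseʳ h d ⟨
      proj₂ (to f (rep a , proj₁ (to h d))) ≡⟨ cong (λ b → proj₂ (to f (rep a , b))) to-h₁ ⟩
      proj₂ (to f (rep a , b₀))             ∎
      where
      d = proj₂ (to f (a , b₀))

      to-h₁ : proj₁ (to h d) ≡ b₀
      to-h₁ = trans (f⁻¹≗k d c₀) (k-f a b₀)

    -- The right side is the reduct of the pair that `Semilocalizable` asks for: `rep a` underlies
    -- the `E`-part of `a`. The first condition settles the `C`-component.
    f≗ : ∀ a b → to f (a , b) ≡ (proj₁ (to f (a , b₀)) , proj₂ (to f (rep a , b)))
    f≗ a b = cong₂ _,_ (trans (f≗g a b) (sym (f≗g a b₀)))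
                       (irrelevant a (rep a) b₀ b (f-rep a))

proposition1p5 : ∀ {ℓ} {A B C D : Set ℓ} (f : (A × B) ↔ (C × D)) →
    (Semilocalizable f →
    Semicausal (Inverse.to f) × Semicausal (Inverse.to (dual f)) × SecondInputIrrelevant (Inverse.to f))
    × (B → C →
    Semicausal (Inverse.to f) × Semicausal (Inverse.to (dual f)) × SecondInputIrrelevant (Inverse.to f) →
    Semilocalizable f)
proposition1p5 f = semilocalizable⇒ f , ⇒semilocalizable f
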